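{- If $G$ is a $3$-connected graph with a triangle $T$ and a $K_5$-minor, then $G$ has a $K_5$-minor in which $E(T)$ is the edge-set of a triangle.
   Context: A triangle of a graph is a cycle of length $3$; $E(T)$ is its set of edges. -}

module Defs where

open import Data.Nat using (ℕ; _≤_; _<_)
open import Data.Fin using (Fin)
open import Data.Fin.Subset using (Subset; _∈_; _∉_; ∣_∣)
open import Data.Bool using (Bool; true; false)
open import Data.Maybe using (Maybe; just)
open import Data.Product using (Σ; _×_; ∃; _,_)
open import Relation.Binary.PropositionalEquality using (_≡_; _≢_)

record Graph (n : ℕ) : Set where
  field
    adj    : Fin n → Fin n → Bool
    sym    : ∀ u v → adj u v ≡ adj v u
    irrefl : ∀ u → adj u u ≡ false

open Graph public

Adj : ∀ {n} → Graph n → Fin n → Fin n → Set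
Adj G u v = adj G u v ≡ true

data Reach {n} (G : Graph n) (P : Fin n → Set) : Fin n → Fin n → Set where
  here : ∀ {u} → P u → Reach G P u u
  step : ∀ {u w v} → Reach G P u w → Adj G w v → P v → Reach G P u v

InducedConnected : ∀ {n} → Graph n → (Fin n → Set) → Set
InducedConnected G P = ∀ u v → P u → P v → Reach G P u v

ThreeConnected : ∀ {n} → Graph n → Set
ThreeConnected {n} G =
  (3 < n) × (∀ (X : Subset n) → ∣ X ∣ < 3 → InducedConnected G (λ x → x ∉ X))

record Triangle {n} (G : Graph n) : Set where
  field
    a b c : Fin n
    ab : Adj G a b
    bc : Adj G b c
    ca : Adj G c a

-- A K5-minor model of G: each vertex is assigned to one of five branch sets
-- (just i) or deleted (nothing); branch sets are nonempty, induce connected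
-- subgraphs, and every two distinct branch sets are joined by an edge.
record K5Model {n} (G : Graph n) : Set where
  field
    branch    : Fin n → Maybe (Fin 5)
    nonempty  : ∀ i → ∃ λ v → branch v ≡ just i
    connected : ∀ i → InducedConnected G (λ v → branch v ≡ just i)
    joined    : ∀ i j → i ≢ j →
                Σ (Fin n) λ u → Σ (Fin n) λ v →
                  branch u ≡ just i × branch v ≡ just j × Adj G u v

open K5Model public

HasK5Minor : ∀ {n} → Graph n → Set
HasK5Minor G = K5Model G

-- In the K5-minor given by the model, E(T) is the edge set of a triangle:
-- the three vertices of T lie in three pairwise distinct branch sets, so that
-- the edges of T are kept (neither contracted nor deleted) as edges of the minor.
PreservesTriangle : ∀ {n} {G : Graph n} → K5Model G → Triangle G → Set
PreservesTriangle M T =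
  Σ (Fin 5) λ i → Σ (Fin 5) λ j → Σ (Fin 5) λ k →
    branch M (Triangle.a T) ≡ just i ×
    branch M (Triangle.b T) ≡ just j ×
    branch M (Triangle.c T) ≡ just k ×
    i ≢ j × j ≢ k × k ≢ i

{-# OPTIONS --safe #-}
module Submission where

-- We may assume that the five branch sets cover G. If the triangle T does not yet meet three of
-- them, then T ⊆ B_p ∪ {x} for some branch set B_p and some x in another branch set B_q. Contract
-- every branch set but B_p. Three disjoint paths from T to distinct branch sets split B_p into
-- three connected parts, one for each vertex of T; one of them remains a branch set, the other two
-- are absorbed by the branch sets their paths lead to, and T is separated.
-- Such paths form a matching of the out-copies of the vertices of B_p into the in-copies of the
-- other vertices, so by Hall's theorem they exist unless fewer than three vertices of the contracted
-- graph cut T off. By 3-connectivity such a cut consists of some u ∈ B_p and some B_j. Move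
-- the part S of B_p behind the cut to B_j: now T ⊆ B_j ∪ {u}, and S is attached to the rest of G
-- only at u and at B_j. When this is repeated, the set moved strictly contains the one moved before,
-- again by 3-connectivity, so the process stops.

open import Defs
open import Data.Bool using (true)
open import Data.Bool.Properties using () renaming (_≟_ to _≟ᵇ_)
open import Data.Empty using (⊥; ⊥-elim)
open import Data.Unit using (⊤; tt)
open import Data.Fin using (Fin; zero; suc)
open import Data.Fin.Patterns using (0F; 1F; 2F)
open import Data.Fin.Properties using (_≟_; any?; all?; suc-injective; 0≢1+n)
open import Data.Fin.Subset using (Subset; _∈_; _∉_; _⊂_; _⊃_; _∪_; _-_; ∣_∣; ⁅_⁆; inside; outside)
open import Data.Fin.Subset.Induction using (⊃-wellFounded)
open import Data.Fin.Subset.Properties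
open import Data.List using (List; []; _∷_; allFin; filter)
import Data.List.Membership.DecPropositional as DecMembership
open import Data.List.Membership.Propositional.Properties using (∈-filter⁺; ∈-filter⁻; ∈-allFin)
open import Data.List.Relation.Unary.Any using (here; there)
open import Data.Maybe using (Maybe; just; nothing; fromMaybe)
open import Data.Maybe.Properties using (just-injective)
open import Data.Nat using (ℕ; zero; suc; _+_; _≤_; _<_; z≤n; s≤s)
open import Data.Nat.Properties using (≤-refl; ≤-reflexive; ≤-trans; ≤-<-trans; <⇒≱; +-monoʳ-≤;
  +-monoˡ-≤; +-monoʳ-<; +-cancelʳ-<; +-suc; m≤n⇒m≤1+n; n≤1+n; module ≤-Reasoning)
open import Data.Product using (Σ; ∃; ∃₂; _×_; _,_; proj₁; proj₂)
open import Data.Sum using (_⊎_; inj₁; inj₂; [_,_]′)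
open import Data.Vec using ([]; _∷_; here; there; tabulate)
open import Data.Vec.Functional using (updateAt)
open import Data.Vec.Functional.Properties using (updateAt-updates; updateAt-minimal)
open import Data.Vec.Properties using (lookup∘tabulate; lookup⇒[]=; []=⇒lookup)
open import Function using (_∘_; const; id)
open import Function.Definitions using (Injective)
open import Induction.WellFounded using (Acc; acc)
open import Relation.Binary.PropositionalEquality using (_≡_; _≢_; refl; trans; cong; cong₂; subst)
  renaming (sym to ≡-sym)
open import Relation.Nullary using (¬_; Dec; yes; no; does; contradiction)
open import Relation.Nullary.Decidable using (_×-dec_; _⊎-dec_; _→-dec_; ¬?; map′; from-yes; dec-true)
open import Relation.Unary using (Decidable)

-- Finite sets

module _ {n : ℕ} {P : Fin n → Set} (P? : Decidable P) where

  abstract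

    ⟪_⟫ : Subset n
    ⟪_⟫ = tabulate (does ∘ P?)

    ∈⟪⟫⁺ : ∀ {v} → P v → v ∈ ⟪_⟫
    ∈⟪⟫⁺ {v} Pv = lookup⇒[]= v ⟪_⟫ (trans (lookup∘tabulate _ v) (dec-true (P? v) Pv))

    ∈⟪⟫⁻ : ∀ {v} → v ∈ ⟪_⟫ → P v
    ∈⟪⟫⁻ {v} v∈ with P? v | trans (≡-sym (lookup∘tabulate (does ∘ P?) v)) ([]=⇒lookup v∈)
    ... | yes Pv | _ = Pv

-- Induction on `p`: the partner of the head is deleted from `q`, and injectivity keeps the partners
-- of the tail away from it. A relation in place of a function lets a partner depend on the proof of
-- membership.
injection⇒∣∣≤ : ∀ {m k} (p : Subset m) (q : Subset k) (R : Fin m → Fin k → Set) →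
  (∀ {i} → i ∈ p → ∃ λ j → j ∈ q × R i j) →
  (∀ {i i′ j} → R i j → R i′ j → i ≡ i′) → ∣ p ∣ ≤ ∣ q ∣
injection⇒∣∣≤ []            q R total inj = z≤n
injection⇒∣∣≤ (outside ∷ p) q R total inj =
  injection⇒∣∣≤ p q (R ∘ suc) (total ∘ there) (λ r r′ → suc-injective (inj r r′))
injection⇒∣∣≤ (inside ∷ p)  q R total inj with total here
... | j , j∈q , Rj = ≤-<-trans
  (injection⇒∣∣≤ p (q - j) (R ∘ suc) total′ (λ r r′ → suc-injective (inj r r′)))
  (x∈p⇒∣p-x∣<∣p∣ j∈q)
  where
  total′ : ∀ {i} → i ∈ p → ∃ λ j′ → j′ ∈ q - j × R (suc i) j′
  total′ i∈p with total (there i∈p)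
  ... | j′ , j′∈q , Rj′ = j′ , x∈p∧x≢y⇒x∈p-y j′∈q (λ { refl → 0≢1+n (inj Rj Rj′) }) , Rj′

∣p∪q∣≤∣p∣+∣q∣ : ∀ {n} (p q : Subset n) → ∣ p ∪ q ∣ ≤ ∣ p ∣ + ∣ q ∣
∣p∪q∣≤∣p∣+∣q∣ []            []            = z≤n
∣p∪q∣≤∣p∣+∣q∣ (outside ∷ p) (outside ∷ q) = ∣p∪q∣≤∣p∣+∣q∣ p q
∣p∪q∣≤∣p∣+∣q∣ (outside ∷ p) (inside ∷ q)  =
  ≤-trans (s≤s (∣p∪q∣≤∣p∣+∣q∣ p q)) (≤-reflexive (≡-sym (+-suc ∣ p ∣ ∣ q ∣)))
∣p∪q∣≤∣p∣+∣q∣ (inside ∷ p)  (outside ∷ q) = s≤s (∣p∪q∣≤∣p∣+∣q∣ p q)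
∣p∪q∣≤∣p∣+∣q∣ (inside ∷ p)  (inside ∷ q)  =
  s≤s (≤-trans (∣p∪q∣≤∣p∣+∣q∣ p q) (+-monoʳ-≤ ∣ p ∣ (n≤1+n ∣ q ∣)))

disjoint⇒∣p∣+∣q∣≤∣p∪q∣ : ∀ {n} (p q : Subset n) → (∀ {x} → x ∈ p → x ∉ q) → ∣ p ∣ + ∣ q ∣ ≤ ∣ p ∪ q ∣
disjoint⇒∣p∣+∣q∣≤∣p∪q∣ []            []            dis = z≤n
disjoint⇒∣p∣+∣q∣≤∣p∪q∣ (outside ∷ p) (outside ∷ q) dis =
  disjoint⇒∣p∣+∣q∣≤∣p∪q∣ p q (λ x y → dis (there x) (there y))
disjoint⇒∣p∣+∣q∣≤∣p∪q∣ (outside ∷ p) (inside ∷ q)  dis =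
  ≤-trans (≤-reflexive (+-suc ∣ p ∣ ∣ q ∣))
          (s≤s (disjoint⇒∣p∣+∣q∣≤∣p∪q∣ p q (λ x y → dis (there x) (there y))))
disjoint⇒∣p∣+∣q∣≤∣p∪q∣ (inside ∷ p)  (outside ∷ q) dis =
  s≤s (disjoint⇒∣p∣+∣q∣≤∣p∪q∣ p q (λ x y → dis (there x) (there y)))
disjoint⇒∣p∣+∣q∣≤∣p∪q∣ (inside ∷ p)  (inside ∷ q)  dis = ⊥-elim (dis here here)

∣image∣≤ : ∀ {k n} (f : Fin k → Fin n) (q : Subset n) → (∀ {v} → v ∈ q → ∃ λ i → f i ≡ v) → ∣ q ∣ ≤ k
∣image∣≤ {k} f q onto = ≤-trans
  (injection⇒∣∣≤ q Data.Fin.Subset.⊤ (λ v i → f i ≡ v)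
    (λ v∈ → proj₁ (onto v∈) , ∈⊤ , proj₂ (onto v∈)) (λ e e′ → trans (≡-sym e) e′))
  (≤-reflexive (∣⊤∣≡n k))

data Path {A : Set} (E : A → A → Set) (r : A) : A → Set where
  done : Path E r r
  _∷ʳ_ : ∀ {v w} → Path E r v → E v w → Path E r w

module _ {n : ℕ} {E : Fin n → Fin n → Set} (E? : ∀ v w → Dec (E v w)) (r : Fin n) where

  private
    -- Adds the end of an edge leaving `C` as long as there is one. Since `C` grows strictly, this
    -- stops, at exactly the set of vertices reachable from `r`; membership in it decides
    -- reachability.
    closure : (C : Subset n) → Acc _⊃_ C → r ∈ C → (∀ {v} → v ∈ C → Path E r v) →
      Σ (Subset n) λ C → r ∈ C × (∀ {v} → v ∈ C → Path E r v) × (∀ {v w} → v ∈ C → E v w → w ∈ C)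
    closure C (acc rec) r∈C path
      with any? (λ v → any? λ w → (v ∈? C) ×-dec (E? v w ×-dec ¬? (w ∈? C)))
    ... | yes (v , w , v∈C , Evw , w∉C) = closure (C ∪ ⁅ w ⁆)
      (rec ((λ x∈C → x∈p∪q⁺ (inj₁ x∈C)) , w , x∈p∪q⁺ (inj₂ (x∈⁅x⁆ w)) , w∉C))
      (x∈p∪q⁺ (inj₁ r∈C))
      (λ x∈ → [ path , (λ x∈w → subst (Path E r) (≡-sym (x∈⁅y⁆⇒x≡y w x∈w)) (path v∈C ∷ʳ Evw)) ]′
              (x∈p∪q⁻ C ⁅ w ⁆ x∈))
    ... | no closed = C , r∈C , path , step-closed
      where
      step-closed : ∀ {v w} → v ∈ C → E v w → w ∈ C
      step-closed {v} {w} v∈C Evw with w ∈? C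
      ... | yes w∈C = w∈C
      ... | no w∉C  = contradiction (v , w , v∈C , Evw , w∉C) closed

  abstract

    path? : ∀ v → Dec (Path E r v)
    path? v with closure ⁅ r ⁆ (⊃-wellFounded ⁅ r ⁆) (x∈⁅x⁆ r)
                   (λ v∈ → subst (Path E r) (≡-sym (x∈⁅y⁆⇒x≡y r v∈)) done)
    ... | C , r∈C , sound , closed = map′ sound complete (v ∈? C)
      where
      complete : ∀ {w} → Path E r w → w ∈ C
      complete done     = r∈C
      complete (p ∷ʳ e) = closed (complete p) e

-- Hall's marriage theorem

module Hall {m k : ℕ} {R : Fin m → Fin k → Set} (R? : ∀ i c → Dec (R i c)) where

  open DecMembership (_≟_ {m}) using () renaming (_∈_ to _∈ˡ_; _∉_ to _∉ˡ_; _∈?_ to _∈ˡ?_)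

  record Matching (P : Fin m → Set) (f : Fin m → Fin k) : Set where
    constructor matching
    field
      edge      : ∀ {i} → P i → R i (f i)
      injective : ∀ {i j} → P i → P j → f i ≡ f j → i ≡ j

  neighbour? : (L : Subset m) → Decidable (λ c → ∃ λ i → i ∈ L × R i c)
  neighbour? L c = any? λ i → (i ∈? L) ×-dec R? i c

  Violator : (Fin m → Set) → Set
  Violator P = Σ (Subset m) λ L → (∀ {i} → i ∈ L → P i) × ∣ ⟪ neighbour? L ⟫ ∣ < ∣ L ∣

  -- Two edges of an alternating path, seen from the rows: from row `i` by any edge to the column
  -- `f i′`, then back to `i′` by the matching edge.
  Alt : (Fin m → Set) → (Fin m → Fin k) → Fin m → Fin m → Set
  Alt P f i i′ = P i′ × R i (f i′)

  Free : (Fin m → Set) → (Fin m → Fin k) → Fin k → Set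
  Free P f c = ∀ {i} → P i → f i ≢ c

  pathLength : ∀ {P f r i} → Path (Alt P f) r i → ℕ
  pathLength done     = 0
  pathLength (p ∷ʳ _) = suc (pathLength p)

  module _ {P : Fin m → Set} {r : Fin m} (r∉P : ¬ P r) where

    -- Matching i with c releases f i; a path that used i is cut off at the row preceding i.
    shorten : ∀ f {i c y} → P i → (p : Path (Alt P f) r y) → R y (f i) →
      let f′ = updateAt f i (const c) in
      ∃ λ y′ → Σ (Path (Alt P f′) r y′) λ p′ → pathLength p′ ≤ pathLength p × R y′ (f i)
    shorten f {i} {c} Pi p Ry = [ (λ (p′ , le) → _ , p′ , le , Ry) , id ]′ (reroute p)
      where
      f′ = updateAt f i (const c)
      reroute : ∀ {z} (p : Path (Alt P f) r z) →
        (Σ (Path (Alt P f′) r z) λ p′ → pathLength p′ ≤ pathLength p) ⊎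
        (∃ λ y′ → Σ (Path (Alt P f′) r y′) λ p′ → pathLength p′ ≤ pathLength p × R y′ (f i))
      reroute done = inj₁ (done , z≤n)
      reroute (_∷ʳ_ {v} {w} p (Pw , Rvw)) with reroute p
      ... | inj₂ (y′ , p′ , le , Ry′) = inj₂ (y′ , p′ , m≤n⇒m≤1+n le , Ry′)
      ... | inj₁ (p′ , le) with w ≟ i
      ...   | yes refl = inj₂ (v , p′ , m≤n⇒m≤1+n le , Rvw)
      ...   | no w≢i   = inj₁ (p′ ∷ʳ (Pw , subst (R v) (≡-sym (updateAt-minimal w i f w≢i)) Rvw) , s≤s le)

    -- Row `i` at the end of the path takes the free column `c` and releases `f i`, which an earlier
    -- row can take in turn, until `r` gets a column. The path is rebuilt for each new matching, so
    -- the recursion is on a bound `ℓ` for its length.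
    augment : ∀ ℓ f {i c} → Matching P f → (p : Path (Alt P f) r i) → pathLength p ≤ ℓ →
      R i c → Free P f c → ∃ (Matching (λ i → i ≡ r ⊎ P i))
    augment ℓ f {c = c} (matching edge inj) done _ Rrc free = f′ , matching edge′ inj′
      where
      f′ = updateAt f r (const c)
      f′r : f′ r ≡ c
      f′r = updateAt-updates r f
      f′P : ∀ {j} → P j → f′ j ≡ f j
      f′P {j} Pj = updateAt-minimal j r f (λ { refl → r∉P Pj })
      edge′ : ∀ {j} → j ≡ r ⊎ P j → R j (f′ j)
      edge′ (inj₁ refl) = subst (R _) (≡-sym f′r) Rrc
      edge′ (inj₂ Pj)   = subst (R _) (≡-sym (f′P Pj)) (edge Pj)
      inj′ : ∀ {i j} → i ≡ r ⊎ P i → j ≡ r ⊎ P j → f′ i ≡ f′ j → i ≡ j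
      inj′ (inj₁ refl) (inj₁ refl) e = refl
      inj′ (inj₁ refl) (inj₂ Pj)   e = contradiction (trans (≡-sym (f′P Pj)) (trans (≡-sym e) f′r)) (free Pj)
      inj′ (inj₂ Pi)   (inj₁ refl) e = contradiction (trans (≡-sym (f′P Pi)) (trans e f′r)) (free Pi)
      inj′ (inj₂ Pi)   (inj₂ Pj)   e = inj Pi Pj (trans (≡-sym (f′P Pi)) (trans e (f′P Pj)))
    augment (suc ℓ) f {i} {c} (matching edge inj) (p ∷ʳ (Pi , Rvi)) (s≤s le) Ric free
      with shorten f {c = c} Pi p Rvi
    ... | y′ , p′ , le′ , Ry′ = augment ℓ f′ (matching edge′ inj′) p′ (≤-trans le′ le) Ry′ free′
      where
      f′ = updateAt f i (const c)
      f′i : f′ i ≡ c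
      f′i = updateAt-updates i f
      f′≢ : ∀ {j} → j ≢ i → f′ j ≡ f j
      f′≢ {j} j≢i = updateAt-minimal j i f j≢i
      edge′ : ∀ {j} → P j → R j (f′ j)
      edge′ {j} Pj with j ≟ i
      ... | yes refl = subst (R j) (≡-sym f′i) Ric
      ... | no j≢i   = subst (R j) (≡-sym (f′≢ j≢i)) (edge Pj)
      inj′ : ∀ {a b} → P a → P b → f′ a ≡ f′ b → a ≡ b
      inj′ {a} {b} Pa Pb e with a ≟ i | b ≟ i
      ... | yes refl | yes refl = refl
      ... | yes refl | no b≢i   = contradiction (trans (≡-sym (f′≢ b≢i)) (trans (≡-sym e) f′i)) (free Pb)
      ... | no a≢i   | yes refl = contradiction (trans (≡-sym (f′≢ a≢i)) (trans e f′i)) (free Pa)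
      ... | no a≢i   | no b≢i   = inj Pa Pb (trans (≡-sym (f′≢ a≢i)) (trans e (f′≢ b≢i)))
      free′ : Free P f′ (f i)
      free′ {j} Pj e with j ≟ i
      ... | yes refl = free Pj (trans (≡-sym e) f′i)
      ... | no j≢i   = j≢i (inj Pj Pi (trans (≡-sym (f′≢ j≢i)) e))

    -- Let `L` be the set of rows that alternating paths from `r` reach. If no neighbour of `L` is
    -- free, each is matched to a row that is again in `L` and is not `r`, so `L` has fewer
    -- neighbours than elements.
    extend : Decidable P → ∀ {f} → Matching P f →
      ∃ (Matching (λ i → i ≡ r ⊎ P i)) ⊎ Violator (λ i → i ≡ r ⊎ P i)
    extend P? {f} M with any? (λ i → any? λ c → alt? i ×-dec (R? i c ×-dec
                                     ¬? (any? λ j → P? j ×-dec (f j ≟ c))))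
      where
      alt? = path? (λ i i′ → P? i′ ×-dec R? i (f i′)) r
    ... | yes (i , c , p , Ric , free) =
      inj₁ (augment (pathLength p) f M p ≤-refl Ric (λ Pj e → free (_ , Pj , e)))
    ... | no stuck = inj₂ (L , L⊆ , ≤-<-trans N≤ (x∈p⇒∣p-x∣<∣p∣ (∈⟪⟫⁺ alt? done)))
      where
      alt? = path? (λ i i′ → P? i′ ×-dec R? i (f i′)) r
      L = ⟪ alt? ⟫
      L⊆ : ∀ {i} → i ∈ L → i ≡ r ⊎ P i
      L⊆ i∈L with ∈⟪⟫⁻ alt? i∈L
      ... | done          = inj₁ refl
      ... | _ ∷ʳ (Pi , _) = inj₂ Pi
      N≤ : ∣ ⟪ neighbour? L ⟫ ∣ ≤ ∣ L - r ∣
      N≤ = injection⇒∣∣≤ _ _ (λ c j → f j ≡ c) total (λ e e′ → trans (≡-sym e) e′)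
        where
        total : ∀ {c} → c ∈ ⟪ neighbour? L ⟫ → ∃ λ j → j ∈ L - r × f j ≡ c
        total {c} c∈N with ∈⟪⟫⁻ (neighbour? L) c∈N
        ... | i , i∈L , Ric with any? (λ j → P? j ×-dec (f j ≟ c))
        ...   | no free = contradiction (i , c , ∈⟪⟫⁻ alt? i∈L , Ric , free) stuck
        ...   | yes (j , Pj , refl) =
          j , x∈p∧x≢y⇒x∈p-y (∈⟪⟫⁺ alt? (∈⟪⟫⁻ alt? i∈L ∷ʳ (Pj , Ric))) (λ { refl → r∉P Pj }) , refl

  hallˡ : Fin k → (rows : List (Fin m)) → ∃ (Matching (_∈ˡ rows)) ⊎ Violator (_∈ˡ rows)
  -- Without rows every function is a matching; `c` merely supplies one.
  hallˡ c []         = inj₁ (const c , matching (λ ()) (λ ()))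
  hallˡ c (r ∷ rows) with hallˡ c rows
  ... | inj₂ (L , L⊆ , lt) = inj₂ (L , there ∘ L⊆ , lt)
  ... | inj₁ (f , M@(matching edge inj)) with r ∈ˡ? rows
  ...   | yes r∈ = inj₁ (f , matching (edge ∘ drop) (λ i j → inj (drop i) (drop j)))
    where
    drop : ∀ {i} → i ∈ˡ r ∷ rows → i ∈ˡ rows
    drop (here refl) = r∈
    drop (there i∈)  = i∈
  ...   | no r∉ with extend r∉ (_∈ˡ? rows) M
  ...     | inj₁ (f′ , matching edge′ inj′) =
    inj₁ (f′ , matching (edge′ ∘ split) (λ i j → inj′ (split i) (split j)))
    where
    split : ∀ {i} → i ∈ˡ r ∷ rows → i ≡ r ⊎ i ∈ˡ rows
    split (here e)   = inj₁ e
    split (there i∈) = inj₂ i∈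
  ...     | inj₂ (L , L⊆ , lt) = inj₂ (L , (λ i∈ → [ here , there ]′ (L⊆ i∈)) , lt)

  hall : Fin k → {P : Fin m → Set} → Decidable P → ∃ (Matching P) ⊎ Violator P
  hall c {P} P? with hallˡ c (filter P? (allFin m))
  ... | inj₁ (f , matching edge inj) =
    inj₁ (f , matching (edge ∘ row) (λ i j → inj (row i) (row j)))
    where
    row : ∀ {i} → P i → i ∈ˡ filter P? (allFin m)
    row {i} = ∈-filter⁺ P? (∈-allFin i)
  ... | inj₂ (L , L⊆ , lt) = inj₂ (L , (λ i∈ → proj₂ (∈-filter⁻ P? {xs = allFin m} (L⊆ i∈))) , lt)

-- Connected sets

module _ {n : ℕ} {G : Graph n} where

  Adj-sym : ∀ {u v} → Adj G u v → Adj G v u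
  Adj-sym {u} {v} uv = trans (sym G v u) uv

  Reach-map : ∀ {P Q : Fin n → Set} → (∀ {v} → P v → Q v) → ∀ {u v} → Reach G P u v → Reach G Q u v
  Reach-map f (here Pu)        = here (f Pu)
  Reach-map f (step r wv Pv) = step (Reach-map f r) wv (f Pv)

  Reach-target : ∀ {P u v} → Reach G P u v → P v
  Reach-target (here Pu)     = Pu
  Reach-target (step _ _ Pv) = Pv

  Reach-trans : ∀ {P u v w} → Reach G P u v → Reach G P v w → Reach G P u w
  Reach-trans r (here _)        = r
  Reach-trans r (step s wv Pv) = step (Reach-trans r s) wv Pv

  Reach-sym : ∀ {P u v} → Reach G P u v → Reach G P v u
  Reach-sym (here Pu)       = here Pu
  Reach-sym (step r wv Pv) = Reach-trans (step (here Pv) (Adj-sym wv) (Reach-target r)) (Reach-sym r)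

  exit : ∀ {P S : Fin n → Set} → Decidable S → ∀ {u v} → Reach G P u v → S u → ¬ S v →
    ∃₂ λ w w′ → S w × ¬ S w′ × Adj G w w′ × P w × P w′
  exit S? (here _) Su ¬Sv = contradiction Su ¬Sv
  exit S? (step {w = w} r wv Pv) Su ¬Sv with S? w
  ... | yes Sw = _ , _ , Sw , ¬Sv , wv , Reach-target r , Pv
  ... | no ¬Sw = exit S? r Su ¬Sw

  closed : ∀ {P S : Fin n → Set} → Decidable S → (∀ {w v} → S w → P v → Adj G w v → S v) →
    ∀ {u v} → Reach G P u v → S u → S v
  closed S? cl {v = v} r Su with S? v
  ... | yes Sv = Sv
  ... | no ¬Sv with exit S? r Su ¬Sv
  ...   | w , w′ , Sw , ¬Sw′ , ww′ , _ , Pw′ = contradiction (cl Sw Pw′ ww′) ¬Sw′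

  connected-resp : ∀ {P Q : Fin n → Set} → (∀ {v} → P v → Q v) → (∀ {v} → Q v → P v) →
    InducedConnected G P → InducedConnected G Q
  connected-resp f g conn u v Qu Qv = Reach-map f (conn u v (g Qu) (g Qv))

  connected-singleton : ∀ w → InducedConnected G (_≡ w)
  connected-singleton w .w .w refl refl = here refl

  connected-⊎ : ∀ {P Q : Fin n → Set} → InducedConnected G P → InducedConnected G Q →
    ∀ {a b} → P a → Q b → Adj G a b → InducedConnected G (λ v → P v ⊎ Q v)
  connected-⊎ {P} {Q} connP connQ {a} {b} Pa Qb ab = conn
    where
    P∪Q : Fin n → Set
    P∪Q v = P v ⊎ Q v
    inP : ∀ {u v} → Reach G P u v → Reach G P∪Q u v
    inP = Reach-map inj₁
    inQ : ∀ {u v} → Reach G Q u v → Reach G P∪Q u v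
    inQ = Reach-map inj₂
    conn : InducedConnected G P∪Q
    conn u v (inj₁ Pu) (inj₁ Pv) = inP (connP u v Pu Pv)
    conn u v (inj₁ Pu) (inj₂ Qv) =
      Reach-trans (step (inP (connP u a Pu Pa)) ab (inj₂ Qb)) (inQ (connQ b v Qb Qv))
    conn u v (inj₂ Qu) (inj₁ Pv) =
      Reach-trans (step (inQ (connQ u b Qu Qb)) (Adj-sym ab) (inj₁ Pa)) (inP (connP a v Pa Pv))
    conn u v (inj₂ Qu) (inj₂ Qv) = inQ (connQ u v Qu Qv)

  -- Removing S leaves P connected if S is attached to P ∖ S at a single vertex a.
  connected-∖ : ∀ {P S : Fin n → Set} → Decidable S → InducedConnected G P →
    ∀ {a} → P a → ¬ S a → (∀ {w v} → S w → P v → ¬ S v → Adj G w v → v ≡ a) →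
    InducedConnected G (λ v → P v × ¬ S v)
  connected-∖ {P} {S} S? conn {a} Pa ¬Sa attach u v (Pu , ¬Su) (Pv , ¬Sv) =
    Reach-trans (Reach-sym (outside-S (conn a u Pa Pu) ¬Su)) (outside-S (conn a v Pa Pv) ¬Sv)
    where
    outside-S : ∀ {v} → Reach G P a v → ¬ S v → Reach G (λ v → P v × ¬ S v) a v
    outside-S (here Pa) ¬Sa = here (Pa , ¬Sa)
    outside-S (step {w = w} r wv Pv) ¬Sv with S? w
    ... | no ¬Sw = step (outside-S r ¬Sw) wv (Pv , ¬Sv)
    ... | yes Sw with attach Sw Pv ¬Sv wv
    ...   | refl = here (Pv , ¬Sv)

  module ExtendLabelling {k : ℕ} {P : Fin n → Set} (P? : Decidable P) (connP : InducedConnected G P) where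

    Labelling : (Fin n → Maybe (Fin k)) → Set
    Labelling lab = (∀ i → InducedConnected G (λ v → lab v ≡ just i)) × (∀ {v i} → lab v ≡ just i → P v)

    labelled? : (lab : Fin n → Maybe (Fin k)) → Decidable (λ v → ∃ λ i → lab v ≡ just i)
    labelled? lab v with lab v
    ... | just i  = yes (i , refl)
    ... | nothing = no (λ ())

    add-label : ∀ lab → Labelling lab → ∀ {w v i} → lab w ≡ just i → ¬ (∃ λ i → lab v ≡ just i) →
      P v → Adj G w v → Labelling (updateAt lab v (const (just i)))
    add-label lab (conn , lab⊆P) {w} {v} {i} labw unlab Pv wv = conn′ , lab′⊆P
      where
      lab′ = updateAt lab v (const (just i))
      new : lab′ v ≡ just i
      new = updateAt-updates v lab
      lab′≢ : ∀ {u} → u ≢ v → lab′ u ≡ lab u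
      lab′≢ {u} u≢v = updateAt-minimal u v lab u≢v
      old⇒new : ∀ {u j} → lab u ≡ just j → lab′ u ≡ just j
      old⇒new labu = trans (lab′≢ λ { refl → unlab (_ , labu) }) labu
      new⇒old : ∀ {u j} → lab′ u ≡ just j → lab u ≡ just j ⊎ (u ≡ v × j ≡ i)
      new⇒old {u} e with u ≟ v
      ... | yes refl = inj₂ (refl , just-injective (trans (≡-sym e) new))
      ... | no u≢v   = inj₁ (trans (≡-sym (lab′≢ u≢v)) e)
      conn′ : ∀ j → InducedConnected G (λ u → lab′ u ≡ just j)
      conn′ j with j ≟ i
      ... | yes refl = connected-resp [ old⇒new , (λ { refl → new }) ]′
                         ([ inj₁ , inj₂ ∘ proj₁ ]′ ∘ new⇒old)
                         (connected-⊎ (conn i) (connected-singleton v) labw refl wv)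
      ... | no j≢i   = connected-resp old⇒new
                         ([ id , (λ (_ , j≡i) → contradiction j≡i j≢i) ]′ ∘ new⇒old) (conn j)
      lab′⊆P : ∀ {u j} → lab′ u ≡ just j → P u
      lab′⊆P e with new⇒old e
      ... | inj₁ labu       = lab⊆P labu
      ... | inj₂ (refl , _) = Pv

    private
      -- While a vertex of `P` is unlabelled, some path in `P` crosses from a labelled `w` to an
      -- unlabelled `w′`, which takes the label of `w`. Classes stay connected and no new label
      -- appears.
      grow : ∀ lab → Labelling lab → Acc _⊃_ ⟪ labelled? lab ⟫ → (∃₂ λ v i → lab v ≡ just i) →
        Σ (Fin n → Maybe (Fin k)) λ lab′ → Labelling lab′ × (∀ {v} → P v → ∃ λ i → lab′ v ≡ just i) ×
          (∀ {v i} → lab v ≡ just i → lab′ v ≡ just i) × (∀ {v i} → lab′ v ≡ just i → ∃ λ u → lab u ≡ just i)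
      grow lab L@(_ , lab⊆P) (acc rec) (v₀ , i₀ , labv₀)
        with any? (λ v → P? v ×-dec ¬? (labelled? lab v))
      ... | no total = lab , L , total′ , id , (_ ,_)
        where
        total′ : ∀ {v} → P v → ∃ λ i → lab v ≡ just i
        total′ {v} Pv with labelled? lab v
        ... | yes l   = l
        ... | no ¬l = contradiction (v , Pv , ¬l) total
      ... | yes (v , Pv , unlab)
        with exit (labelled? lab) (connP v₀ v (lab⊆P labv₀) Pv) (i₀ , labv₀) unlab
      ...   | w , w′ , (i , labw) , unlab′ , ww′ , _ , Pw′
        with grow lab′ (add-label lab L labw unlab′ Pw′ ww′)
               (rec ((λ u∈ → let j , labu = ∈⟪⟫⁻ (labelled? lab) u∈ in
                             ∈⟪⟫⁺ (labelled? lab′) (j , old⇒new labu))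
                    , w′ , ∈⟪⟫⁺ (labelled? lab′) (i , updateAt-updates w′ lab)
                    , unlab′ ∘ ∈⟪⟫⁻ (labelled? lab)))
               (v₀ , i₀ , old⇒new labv₀)
        where
        lab′ = updateAt lab w′ (const (just i))
        old⇒new : ∀ {u j} → lab u ≡ just j → lab′ u ≡ just j
        old⇒new {u} labu = trans (updateAt-minimal u w′ lab λ { refl → unlab′ (_ , labu) }) labu
      ...     | lab″ , L″ , total , ext , used = lab″ , L″ , total ,
        (λ {u} labu → ext (trans (updateAt-minimal u w′ lab λ { refl → unlab′ (_ , labu) }) labu)) ,
        λ {u} labu → used′ (used labu)
        where
        used′ : ∀ {j} → (∃ λ u → updateAt lab w′ (const (just i)) u ≡ just j) → ∃ λ u → lab u ≡ just j
        used′ (u , e) with u ≟ w′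
        ... | yes refl = w , trans labw (trans (≡-sym (updateAt-updates w′ lab)) e)
        ... | no u≢w′  = u , trans (≡-sym (updateAt-minimal u w′ lab u≢w′)) e

    abstract

      -- Outside `P` the total function takes the default value `i₀`, hence the restriction of the
      -- classes to `P`. The last component keeps the class of a label empty if it was empty before.
      extend-labelling : ∀ lab → Labelling lab → (∃₂ λ v i → lab v ≡ just i) →
        Σ (Fin n → Fin k) λ lab′ → (∀ i → InducedConnected G (λ v → P v × lab′ v ≡ i)) ×
          (∀ {v i} → lab v ≡ just i → lab′ v ≡ i) × (∀ {v} → P v → ∃ λ u → lab u ≡ just (lab′ v))
      extend-labelling lab L some@(_ , i₀ , _) with grow lab L (⊃-wellFounded _) some
      ... | lab′ , (conn , lab′⊆P) , total , ext , used = fromMaybe i₀ ∘ lab′ ,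
        (λ i → connected-resp (λ e → lab′⊆P e , cong (fromMaybe i₀) e) class (conn i)) ,
        (λ labv → cong (fromMaybe i₀) (ext labv)) ,
        (λ Pv → used (class (Pv , refl)))
        where
        class : ∀ {v i} → P v × fromMaybe i₀ (lab′ v) ≡ i → lab′ v ≡ just i
        class (Pv , refl) with total Pv
        ... | j , e = trans e (cong (just ∘ fromMaybe i₀) (≡-sym e))

-- Models whose branch sets cover the graph

record Partition {n} (G : Graph n) : Set where
  field
    part           : Fin n → Fin 5
    part-nonempty  : ∀ i → ∃ λ v → part v ≡ i
    part-connected : ∀ i → InducedConnected G (λ v → part v ≡ i)
    part-joined    : ∀ i j → i ≢ j → ∃₂ λ u v → part u ≡ i × part v ≡ j × Adj G u v

model : ∀ {n} {G : Graph n} → Partition G → K5Model G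
model M = record
  { branch    = just ∘ part
  ; nonempty  = λ i → let v , e = part-nonempty i in v , cong just e
  ; connected = λ i → connected-resp (cong just) just-injective (part-connected i)
  ; joined    = λ i j i≢j → let u , v , eu , ev , uv = part-joined i j i≢j in
                  u , v , cong just eu , cong just ev , uv
  }
  where open Partition M

-- As `G` is connected, the deleted vertices can be absorbed one by one by adjacent branch sets; the
-- edges joining the branch sets survive.
partition : ∀ {n} {G : Graph n} → InducedConnected G (λ _ → ⊤) → K5Model G → Partition G
partition {n} {G} connG M with extend-labelling (branch M) (connected M , _) (v₀ , zero , labv₀)
  where
  open ExtendLabelling {G = G} {k = 5} (λ _ → yes tt) connG
  v₀    = proj₁ (nonempty M zero)
  labv₀ = proj₂ (nonempty M zero)
... | lab , conn , ext , _ = record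
  { part           = lab
  ; part-nonempty  = λ i → let v , e = nonempty M i in v , ext e
  ; part-connected = λ i → connected-resp proj₂ (tt ,_) (conn i)
  ; part-joined    = λ i j i≢j → let u , v , eu , ev , uv = joined M i j i≢j in u , v , ext eu , ext ev , uv
  }

abstract

  -- Decided by running through all quadruples. In the use of it, `p` is the branch set to be split,
  -- `a`, `b`, `c` are those where the three paths end, and `l` is the remaining one.
  fifth : ∀ (p a b c : Fin 5) → p ≢ a → p ≢ b → p ≢ c → a ≢ b → a ≢ c → b ≢ c →
    ∃ λ l → l ≢ p × ∀ j → j ≢ p → j ≡ a ⊎ j ≡ b ⊎ j ≡ c ⊎ j ≡ l
  fifth = from-yes (all? λ (p : Fin 5) → all? λ a → all? λ b → all? λ c →
    ¬? (p ≟ a) →-dec (¬? (p ≟ b) →-dec (¬? (p ≟ c) →-dec (¬? (a ≟ b) →-dec (¬? (a ≟ c) →-dec (¬? (b ≟ c) →-dec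
    any? λ l → ¬? (l ≟ p) ×-dec all? λ j → ¬? (j ≟ p) →-dec
      ((j ≟ a) ⊎-dec ((j ≟ b) ⊎-dec ((j ≟ c) ⊎-dec (j ≟ l))))))))))

  avoid : ∀ (a b c : Fin 5) → ∃ λ l → l ≢ a × l ≢ b × l ≢ c
  avoid = from-yes (all? λ (a : Fin 5) → all? λ b → all? λ c → any? λ l → ¬? (l ≟ a) ×-dec (¬? (l ≟ b) ×-dec ¬? (l ≟ c)))

three∈⇒3≤∣p∣ : ∀ {n} {p : Subset n} {a b c} → a ∈ p → b ∈ p → c ∈ p → b ≢ a → c ≢ a → c ≢ b → 3 ≤ ∣ p ∣
three∈⇒3≤∣p∣ {p = p} {a} {b} {c} a∈ b∈ c∈ b≢a c≢a c≢b =
  ≤-trans (s≤s (≤-trans (s≤s (≤-trans (s≤s z≤n) (x∈p⇒∣p-x∣<∣p∣ c∈′))) (x∈p⇒∣p-x∣<∣p∣ b∈′))) (x∈p⇒∣p-x∣<∣p∣ a∈)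
  where
  b∈′ : b ∈ p - a
  b∈′ = x∈p∧x≢y⇒x∈p-y b∈ b≢a
  c∈′ : c ∈ p - a - b
  c∈′ = x∈p∧x≢y⇒x∈p-y (x∈p∧x≢y⇒x∈p-y c∈ c≢a) c≢b

∣⁅v⁆∪⁅w⁆∣<3 : ∀ {n} (v w : Fin n) → ∣ ⁅ v ⁆ ∪ ⁅ w ⁆ ∣ < 3
∣⁅v⁆∪⁅w⁆∣<3 v w = s≤s (≤-trans (∣p∪q∣≤∣p∣+∣q∣ ⁅ v ⁆ ⁅ w ⁆)
  (≤-reflexive (cong₂ _+_ (∣⁅x⁆∣≡1 v) (∣⁅x⁆∣≡1 w))))

joined-from : ∀ {k} {E : Fin k → Fin k → Set} (p : Fin k) → (∀ {i j} → E i j → E j i) →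
  (∀ j → j ≢ p → E p j) → (∀ i j → i ≢ p → j ≢ p → i ≢ j → E i j) → ∀ i j → i ≢ j → E i j
joined-from p E-sym at-p off-p i j i≢j with i ≟ p | j ≟ p
... | yes refl | yes refl = contradiction refl i≢j
... | yes refl | no j≢p   = at-p j j≢p
... | no i≢p   | yes refl = E-sym (at-p i i≢p)
... | no i≢p   | no j≢p   = off-p i j i≢p j≢p i≢j

-- Separating the triangle by a split of one branch set

module _ {n : ℕ} {G : Graph n} where

  -- The class of the label that is attached to the branch set l outside p and term becomes
  -- the branch set p; every other class m is absorbed by the branch set term m.
  link : (M : Partition G) → let open Partition M in
    (t : Fin 3 → Fin n) → (∀ {m m′} → m ≢ m′ → Adj G (t m) (t m′)) →
    (p : Fin 5) (lab : Fin n → Fin 3) → (∀ m → InducedConnected G (λ v → part v ≡ p × lab v ≡ m)) →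
    (term : Fin 3 → Fin 5) → Injective _≡_ _≡_ term → (∀ m → term m ≢ p) →
    (∀ m → (part (t m) ≡ p × lab (t m) ≡ m ×
              ∃₂ λ v w → part v ≡ p × lab v ≡ m × part w ≡ term m × Adj G v w) ⊎
           (part (t m) ≡ term m × (∀ {v} → part v ≡ p → lab v ≢ m))) →
    Σ (Partition G) λ M′ → Injective _≡_ _≡_ (Partition.part M′ ∘ t)
  link M t t-adj p lab lab-conn term term-inj term≢p anchor
    with fifth p (term zero) (term (suc zero)) (term (suc (suc zero)))
           (term≢p _ ∘ ≡-sym) (term≢p _ ∘ ≡-sym) (term≢p _ ∘ ≡-sym)
           (λ e → 0≢1+n (term-inj e)) (λ e → 0≢1+n (term-inj e)) (λ e → 0≢1+n (suc-injective (term-inj e)))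
  ... | l , l≢p , only with Partition.part-joined M p l (l≢p ∘ ≡-sym)
  ...   | y , z , part-y , part-z , yz = record
      { part           = part′
      ; part-nonempty  = nonempty′
      ; part-connected = connected′
      ; part-joined    = joined-from p (λ (u , v , eu , ev , uv) → v , u , ev , eu , Adj-sym {G = G} uv)
                           joined-p joined-off
      } , λ {m} {m′} e → color-inj (trans (≡-sym (part′-t m)) (trans e (part′-t m′)))
    where
    open Partition M
    m₀ : Fin 3
    m₀ = lab y

    color : Fin 3 → Fin 5
    color m with m ≟ m₀
    ... | yes _ = p
    ... | no _  = term m

    color-m₀ : color m₀ ≡ p
    color-m₀ with m₀ ≟ m₀
    ... | yes _ = refl
    ... | no ≢  = contradiction refl ≢

    color-≢ : ∀ {m} → m ≢ m₀ → color m ≡ term m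
    color-≢ {m} m≢ with m ≟ m₀
    ... | yes e = contradiction e m≢
    ... | no _  = refl

    color-inj : Injective _≡_ _≡_ color
    color-inj {m} {m′} e with m ≟ m₀ | m′ ≟ m₀
    ... | yes refl | yes refl = refl
    ... | yes _    | no _     = contradiction (≡-sym e) (term≢p m′)
    ... | no _     | yes _    = contradiction e (term≢p m)
    ... | no _     | no _     = term-inj e

    part′ : Fin n → Fin 5
    part′ v with part v ≟ p
    ... | yes _ = color (lab v)
    ... | no _  = part v

    part′-in : ∀ {v} → part v ≡ p → part′ v ≡ color (lab v)
    part′-in {v} e with part v ≟ p
    ... | yes _ = refl
    ... | no ≢p = contradiction e ≢p

    part′-out : ∀ {v i} → part v ≡ i → i ≢ p → part′ v ≡ i
    part′-out {v} refl i≢p with part v ≟ p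
    ... | yes e = contradiction e i≢p
    ... | no _  = refl

    part′-lab : ∀ {v m} → part v ≡ p → lab v ≡ m → part′ v ≡ color m
    part′-lab e refl = part′-in e

    part′-p : ∀ {v} → part′ v ≡ p → part v ≡ p × lab v ≡ m₀
    part′-p {v} e with part v ≟ p
    ... | yes e′ = e′ , color-inj (trans e (≡-sym color-m₀))
    ... | no ≢p  = contradiction e ≢p

    part′-≢p : ∀ {v i} → part′ v ≡ i → i ≢ p → part v ≡ i ⊎ (part v ≡ p × lab v ≢ m₀ × term (lab v) ≡ i)
    part′-≢p {v} e i≢p with part v ≟ p
    ... | no _ = inj₁ e
    ... | yes e′ with lab v ≟ m₀
    ...   | yes _  = contradiction (≡-sym e) i≢p
    ...   | no ≢m₀ = inj₂ (e′ , ≢m₀ , e)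

    part′-t : ∀ m → part′ (t m) ≡ color m
    part′-t m with anchor m
    ... | inj₁ (e , e′ , _) = part′-lab e e′
    -- The class of `m` is empty while `y` is in the class of `m₀`, so `m` is not `m₀`.
    ... | inj₂ (e , empty)  = trans (part′-out e (term≢p m)) (≡-sym (color-≢ λ { refl → empty part-y refl }))

    nonempty′ : ∀ i → ∃ λ v → part′ v ≡ i
    nonempty′ i with i ≟ p
    ... | yes refl = y , trans (part′-in part-y) color-m₀
    ... | no i≢p   = let v , e = part-nonempty i in v , part′-out e i≢p

    connected′ : ∀ i → InducedConnected G (λ v → part′ v ≡ i)
    connected′ i with i ≟ p
    ... | yes refl = connected-resp (λ (e , e′) → trans (part′-lab e e′) color-m₀) part′-p (lab-conn m₀)
    ... | no i≢p with any? (λ m → ¬? (m ≟ m₀) ×-dec (term m ≟ i))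
    ...   | no ∄m = connected-resp (λ e → part′-out e i≢p)
                      (λ e → [ id , (λ (_ , ≢m₀ , e′) → contradiction (_ , ≢m₀ , e′) ∄m) ]′ (part′-≢p e i≢p))
                      (part-connected i)
    -- The branch set `term m` absorbs the class of `m`, attached to it by the last edge of the
    -- path, unless that class is empty.
    ...   | yes (m , m≢m₀ , refl) with anchor m
    ...     | inj₁ (_ , _ , v , w , part-v , lab-v , part-w , vw) =
      connected-resp
        [ (λ e → part′-out e i≢p) , (λ (e , e′) → trans (part′-lab e e′) (color-≢ m≢m₀)) ]′
        (λ e → [ inj₁ , (λ (e′ , _ , e″) → inj₂ (e′ , term-inj e″)) ]′ (part′-≢p e i≢p))
        (connected-⊎ (part-connected (term m)) (lab-conn m) part-w (part-v , lab-v) (Adj-sym {G = G} vw))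
    ...     | inj₂ (_ , empty) = connected-resp (λ e → part′-out e i≢p)
        (λ e → [ id , (λ (e′ , _ , e″) → contradiction (term-inj e″) (empty e′)) ]′ (part′-≢p e i≢p))
        (part-connected (term m))

    Joined : Fin 5 → Fin 5 → Set
    Joined i j = ∃₂ λ u v → part′ u ≡ i × part′ v ≡ j × Adj G u v

    -- For `m` other than `m₀` an edge of the triangle does it, its ends now being in `p` and
    -- `term m`. For `m₀` itself the last edge of its path does.
    joined-term : ∀ m → Joined p (term m)
    joined-term m with m ≟ m₀
    ... | no m≢m₀ = t m₀ , t m , trans (part′-t m₀) color-m₀ , trans (part′-t m) (color-≢ m≢m₀)
                  , t-adj (m≢m₀ ∘ ≡-sym)
    ... | yes refl with anchor m₀
    ...   | inj₁ (_ , _ , v , w , part-v , lab-v , part-w , vw) =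
      v , w , trans (part′-lab part-v lab-v) color-m₀ , part′-out part-w (term≢p m₀) , vw
    ...   | inj₂ (_ , empty) = contradiction refl (empty part-y)

    joined-p : ∀ j → j ≢ p → Joined p j
    joined-p j j≢p with only j j≢p
    ... | inj₁ refl               = joined-term zero
    ... | inj₂ (inj₁ refl)        = joined-term (suc zero)
    ... | inj₂ (inj₂ (inj₁ refl)) = joined-term (suc (suc zero))
    ... | inj₂ (inj₂ (inj₂ refl)) = y , z , trans (part′-in part-y) color-m₀ , part′-out part-z j≢p , yz

    joined-off : ∀ i j → i ≢ p → j ≢ p → i ≢ j → Joined i j
    joined-off i j i≢p j≢p i≢j = let u , v , eu , ev , uv = part-joined i j i≢j in
      u , v , part′-out eu i≢p , part′-out ev j≢p , uv

-- The states of the iteration and the linkage problem they pose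

module _ {n : ℕ} {G : Graph n} (3-conn : ∀ (X : Subset n) → ∣ X ∣ < 3 → InducedConnected G (_∉ X))
  (t : Fin 3 → Fin n) (t-adj : ∀ {m m′} → m ≢ m′ → Adj G (t m) (t m′)) where

  Win : Set
  Win = Σ (Partition G) λ M → Injective _≡_ _≡_ (Partition.part M ∘ t)

  t-injective : Injective _≡_ _≡_ t
  t-injective {m} {m′} e with m ≟ m′
  ... | yes m≡m′ = m≡m′
  ... | no m≢m′ with trans (≡-sym (irrefl G (t m′))) (subst (λ v → Adj G v (t m′)) e (t-adj m≢m′))
  ...   | ()

  -- W is the set moved into the branch set p by the previous step (empty at the beginning).
  record State (W : Subset n) : Set where
    field
      M : Partition G
    open Partition M public
    field
      p q : Fin 5
      x : Fin n
      q≢p : q ≢ p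
      part-x : part x ≡ q
      t∈ : ∀ m → part (t m) ≡ p ⊎ t m ≡ x
      W⊆p : ∀ {v} → v ∈ W → part v ≡ p
      W-connected : InducedConnected G (_∈ W)
      W-meets-t : ∀ {v} → v ∈ W → ∃ λ m → t m ∈ W
      -- After a move, the branch set `p` without `W` is the branch set that absorbed `W`, as it was
      -- before. This field and the next keep the next cut vertex out of `W`.
      rest-connected : InducedConnected G (λ v → part v ≡ p × v ∉ W)
      rest-joined : ∀ l → l ≢ p → l ≢ q → ∃₂ λ y z → part y ≡ p × y ∉ W × part z ≡ l × Adj G y z
      -- Keeps the next set moved from lying inside `W`: otherwise `x` and the next cut vertex would
      -- separate it from the rest of `G`.
      W-attached : ∀ {w v} → w ∈ W → Adj G w v → part v ≡ p ⊎ v ≡ x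

  module Advance {W : Subset n} (state : State W) where
    open State state

    -- The vertex `x` has to represent its branch set: if it belongs to `T`, it is then itself the
    -- end of its path. The other choices are arbitrary.
    rep : Fin 5 → Fin n
    rep j with j ≟ q
    ... | yes _ = x
    ... | no _  = proj₁ (part-nonempty j)

    part-rep : ∀ j → part (rep j) ≡ j
    part-rep j with j ≟ q
    ... | yes refl = part-x
    ... | no _     = proj₂ (part-nonempty j)

    rep-q : rep q ≡ x
    rep-q with q ≟ q
    ... | yes _ = refl
    ... | no ≢  = contradiction refl ≢

    rep-injective : ∀ {i j} → rep i ≡ rep j → i ≡ j
    rep-injective {i} {j} e = trans (≡-sym (part-rep i)) (trans (cong part e) (part-rep j))

    IsT : Fin n → Set
    IsT v = ∃ λ m → t m ≡ v

    isT? : Decidable IsT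
    isT? v = any? λ m → t m ≟ v

    -- Each branch set other than p is contracted to its representative. An edge v – v in the
    -- matching marks v ∈ p as unused by the paths.
    Link : Fin n → Fin n → Set
    Link i v = (part v ≡ p × (i ≡ v ⊎ Adj G i v)) ⊎
               (part v ≢ p × rep (part v) ≡ v × ∃ λ w → part w ≡ part v × Adj G i w)

    adj? : ∀ u v → Dec (Adj G u v)
    adj? u v = adj G u v ≟ᵇ true

    link? : ∀ i v → Dec (Link i v)
    link? i v = ((part v ≟ p) ×-dec ((i ≟ v) ⊎-dec adj? i v)) ⊎-dec
      (¬? (part v ≟ p) ×-dec ((rep (part v) ≟ v) ×-dec any? λ w → (part w ≟ part v) ×-dec adj? i w))

    -- Vertices of `T` are no columns: those in `p` may only be starting points of paths, and if `x`
    -- is in `T`, the branch set `q` is thereby reserved for the trivial path at `x`.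
    R : Fin n → Fin n → Set
    R i v = ¬ IsT v × Link i v

    R? : ∀ i v → Dec (R i v)
    R? i v = ¬? (isT? v) ×-dec link? i v

    open Hall R? hiding (extend)

    -- From a matching to disjoint paths

    module FromMatching (f : Fin n → Fin n) (M-f : Matching (λ v → part v ≡ p) f) where
      open Matching M-f

      -- Iterating `f` from a vertex of `T` traces its path up to the last vertex in `p`.
      Next : Fin n → Fin n → Set
      Next v w = w ≡ f v × part w ≡ p

      orbit? : ∀ r v → Dec (Path Next r v)
      orbit? = path? (λ v w → (w ≟ f v) ×-dec (part w ≟ p))

      orbit⊆p : ∀ {r v} → part r ≡ p → Path Next r v → part v ≡ p
      orbit⊆p e done          = e
      orbit⊆p e (_ ∷ʳ (_ , e′)) = e′

      image∌t : ∀ {v w} → part v ≡ p → w ≡ f v → ¬ IsT w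
      image∌t e refl = proj₁ (edge e)

      -- Trace both orbits backwards from `v`: by injectivity of `f` they agree until one reaches
      -- its start. That is a vertex of `T`, hence not a value of `f` on `p`, so the other orbit
      -- starts there too.
      orbits-disjoint : ∀ {r r′ v} → part r ≡ p → part r′ ≡ p → IsT r → IsT r′ →
        Path Next r v → Path Next r′ v → r ≡ r′
      orbits-disjoint e e′ T T′ done done = refl
      orbits-disjoint e e′ T T′ done (o′ ∷ʳ (≡f , _)) = contradiction T (image∌t (orbit⊆p e′ o′) ≡f)
      orbits-disjoint e e′ T T′ (o ∷ʳ (≡f , _)) done = contradiction T′ (image∌t (orbit⊆p e o) ≡f)
      orbits-disjoint e e′ T T′ (o ∷ʳ (≡f , _)) (o′ ∷ʳ (≡f′ , _))
        with injective (orbit⊆p e o) (orbit⊆p e′ o′) (trans (≡-sym ≡f) ≡f′)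
      ... | refl = orbits-disjoint e e′ T T′ o o′

      -- An orbit inside p would be mapped injectively into itself, missing its starting point.
      orbit-leaves : ∀ m → part (t m) ≡ p → ∃ λ v → Path Next (t m) v × part (f v) ≢ p
      orbit-leaves m e with any? (λ v → orbit? (t m) v ×-dec ¬? (part (f v) ≟ p))
      ... | yes leaves = leaves
      ... | no stays = contradiction
        (injection⇒∣∣≤ O (O - t m) (λ v w → part v ≡ p × f v ≡ w) total
          (λ (e , ≡w) (e′ , ≡w′) → injective e e′ (trans ≡w (≡-sym ≡w′))))
        (<⇒≱ (x∈p⇒∣p-x∣<∣p∣ (∈⟪⟫⁺ (orbit? (t m)) done)))
        where
        O = ⟪ orbit? (t m) ⟫
        total : ∀ {v} → v ∈ O → ∃ λ w → w ∈ O - t m × (part v ≡ p × f v ≡ w)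
        total {v} v∈O with ∈⟪⟫⁻ (orbit? (t m)) v∈O
        ... | o with part (f v) ≟ p
        ...   | no ≢p = contradiction (v , o , ≢p) stays
        ...   | yes ≡p = f v
          , x∈p∧x≢y⇒x∈p-y (∈⟪⟫⁺ (orbit? (t m)) (o ∷ʳ (refl , ≡p)))
              (λ fv≡t → image∌t (orbit⊆p e o) refl (m , ≡-sym fv≡t))
          , orbit⊆p e o , refl

      Reaches : Fin 3 → Fin n → Set
      Reaches m y = ∃ λ v → Path Next (t m) v × f v ≡ y × ∃ λ w → part w ≡ part y × Adj G v w

      -- A vertex of `T` outside `p` is `x`, hence a representative and its own end. For the others
      -- the first value of `f` outside `p` is the end, and `Link` makes it a representative.
      ends : ∀ m → ∃ λ y → part y ≢ p × rep (part y) ≡ y ×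
        ((part (t m) ≡ p × Reaches m y) ⊎ (part (t m) ≢ p × y ≡ t m))
      ends m with part (t m) ≟ p
      ... | no ≢p with t∈ m
      ...   | inj₁ ≡p = contradiction ≡p ≢p
      ...   | inj₂ ≡x = t m , ≢p
        , trans (cong rep (trans (cong part ≡x) part-x)) (trans rep-q (≡-sym ≡x)) , inj₂ (≢p , refl)
      ends m | yes ≡p with orbit-leaves m ≡p
      ...   | v , o , ≢p with edge (orbit⊆p ≡p o)
      ...     | _ , inj₁ (≡p′ , _) = contradiction ≡p′ ≢p
      ...     | _ , inj₂ (_ , rep≡ , w) = f v , ≢p , rep≡ , inj₁ (≡p , v , o , refl , w)

      end : Fin 3 → Fin n
      end m = proj₁ (ends m)

      -- If both ends are values of `f`, the orbits share a vertex by injectivity and so have the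
      -- same start. A value of `f` never equals the end of a trivial path, which is in `T`.
      end-injective : ∀ {m m′} → end m ≡ end m′ → m ≡ m′
      end-injective {m} {m′} e with ends m | ends m′
      ... | y , _ , _ , inj₁ (≡p , v , o , fv≡y , _) | y′ , _ , _ , inj₁ (≡p′ , v′ , o′ , fv′≡y′ , _)
        with injective (orbit⊆p ≡p o) (orbit⊆p ≡p′ o′) (trans fv≡y (trans e (≡-sym fv′≡y′)))
      ...   | refl = t-injective (orbits-disjoint ≡p ≡p′ (m , refl) (m′ , refl) o o′)
      end-injective {m} {m′} e
          | y , _ , _ , inj₁ (≡p , v , o , fv≡y , _) | y′ , _ , _ , inj₂ (_ , ≡t) =
        contradiction (m′ , trans (≡-sym ≡t) (trans (≡-sym e) (≡-sym fv≡y))) (image∌t (orbit⊆p ≡p o) refl)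
      end-injective {m} {m′} e
          | y , _ , _ , inj₂ (_ , ≡t) | y′ , _ , _ , inj₁ (≡p′ , v′ , o′ , fv′≡y′ , _) =
        contradiction (m , trans (≡-sym ≡t) (trans e (≡-sym fv′≡y′))) (image∌t (orbit⊆p ≡p′ o′) refl)
      end-injective {m} {m′} e | y , _ , _ , inj₂ (_ , ≡t) | y′ , _ , _ , inj₂ (_ , ≡t′) =
        t-injective (trans (≡-sym ≡t) (trans e ≡t′))

      term : Fin 3 → Fin 5
      term = part ∘ end

      term-injective : Injective _≡_ _≡_ term
      term-injective {m} {m′} e = end-injective
        (trans (≡-sym (proj₁ (proj₂ (proj₂ (ends m))))) (trans (cong rep e) (proj₁ (proj₂ (proj₂ (ends m′))))))

      -- The first condition makes the class empty when `t m` lies outside `p`; the trivial path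
      -- would otherwise put `t m` into it.
      Class : Fin 3 → Fin n → Set
      Class m v = part (t m) ≡ p × Path Next (t m) v

      class? : ∀ m v → Dec (Class m v)
      class? m v = (part (t m) ≟ p) ×-dec orbit? (t m) v

      class-unique : ∀ {m m′ v} → Class m v → Class m′ v → m ≡ m′
      class-unique (e , o) (e′ , o′) = t-injective (orbits-disjoint e e′ (_ , refl) (_ , refl) o o′)

      class-connected : ∀ m → InducedConnected G (Class m)
      class-connected m u v (e , o) (_ , o′) = Reach-trans (Reach-sym (from-t o)) (from-t o′)
        where
        from-t : ∀ {v} → Path Next (t m) v → Reach G (Class m) (t m) v
        from-t done = here (e , done)
        from-t (_∷ʳ_ {v} o (refl , ≡p)) with edge (orbit⊆p e o)
        ... | _ , inj₁ (_ , inj₁ v≡fv) = subst (Reach G (Class m) (t m)) v≡fv (from-t o)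
        ... | _ , inj₁ (_ , inj₂ vfv)  = step (from-t o) vfv (e , o ∷ʳ (refl , ≡p))
        ... | _ , inj₂ (≢p , _)        = contradiction ≡p ≢p

      lab₀ : Fin n → Maybe (Fin 3)
      lab₀ v with any? (λ m → class? m v)
      ... | yes (m , _) = just m
      ... | no _        = nothing

      lab₀-sound : ∀ {v m} → lab₀ v ≡ just m → Class m v
      lab₀-sound {v} e with any? (λ m → class? m v)
      lab₀-sound refl | yes (m , c) = c

      lab₀-complete : ∀ {v m} → Class m v → lab₀ v ≡ just m
      lab₀-complete {v} c with any? (λ m → class? m v)
      ... | yes (m′ , c′) = cong just (class-unique c′ c)
      ... | no ∄m         = contradiction (_ , c) ∄m

      some-labelled : ∃₂ λ v m → lab₀ v ≡ just m
      -- At most one vertex of `T` equals `x`, so one of any two lies in `p`.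
      some-labelled with t∈ zero | t∈ (suc zero)
      ... | inj₁ ≡p | _       = t zero , zero , lab₀-complete (≡p , done)
      ... | inj₂ _  | inj₁ ≡p = t (suc zero) , suc zero , lab₀-complete (≡p , done)
      ... | inj₂ e  | inj₂ e′ = contradiction (t-injective (trans e (≡-sym e′))) 0≢1+n

      -- The orbits are extended to classes covering the branch set `p`, to which `link` applies. No
      -- new label arises, so a vertex of `T` outside `p` keeps an empty class, as `anchor` demands.
      win : Win
      win = from-labelling (ExtendLabelling.extend-labelling (λ v → part v ≟ p) (part-connected p) lab₀
        ( (λ m → connected-resp lab₀-complete lab₀-sound (class-connected m))
        , (λ e → let ≡p , o = lab₀-sound e in orbit⊆p ≡p o) )
        some-labelled)
        where
        from-labelling : (Σ (Fin n → Fin 3) λ lab → (∀ m → InducedConnected G (λ v → part v ≡ p × lab v ≡ m)) ×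
          (∀ {v m} → lab₀ v ≡ just m → lab v ≡ m) × (∀ {v} → part v ≡ p → ∃ λ u → lab₀ u ≡ just (lab v))) → Win
        from-labelling (lab , conn , ext , used) =
          link M t t-adj p lab conn term term-injective (λ m → proj₁ (proj₂ (ends m))) anchor
          where
          anchor : ∀ m → (part (t m) ≡ p × lab (t m) ≡ m ×
                     ∃₂ λ v w → part v ≡ p × lab v ≡ m × part w ≡ term m × Adj G v w) ⊎
                   (part (t m) ≡ term m × (∀ {v} → part v ≡ p → lab v ≢ m))
          anchor m with ends m
          ... | y , _ , _ , inj₁ (≡p , v , o , _ , w , part-w , vw) = inj₁
            (≡p , ext (lab₀-complete (≡p , done)) , v , w , orbit⊆p ≡p o , ext (lab₀-complete (≡p , o)) , part-w , vw)
          ... | y , _ , _ , inj₂ (≢p , refl) = inj₂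
            (refl , λ e labv → let _ , e′ = used e in
                     ≢p (proj₁ (lab₀-sound (trans e′ (cong just labv)))))

    -- The vertex `u` and the contracted branch set `j` cut off `S`. The last field speaks of
    -- `rep j` rather than of the whole branch set because the cut is found among representatives.
    record Cut : Set where
      field
        u : Fin n
        j : Fin 5
        S : Subset n
        m₀ : Fin 3
        part-u : part u ≡ p
        j≢p : j ≢ p
        u∉S : u ∉ S
        S⊆p : ∀ {v} → v ∈ S → part v ≡ p
        S-connected : InducedConnected G (_∈ S)
        S-attached : ∀ {s v} → s ∈ S → Adj G s v → v ∉ S → v ≡ u ⊎ part v ≡ j
        t₀∈S : t m₀ ∈ S
        t∈S : ∀ m → t m ∈ S ⊎ (t m ≡ u ⊎ t m ≡ rep j)

    -- From a violator of Hall's condition to a cut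

    module FromViolator (L : Subset n) (L⊆p : ∀ {v} → v ∈ L → part v ≡ p)
      (N<L : ∣ ⟪ neighbour? L ⟫ ∣ < ∣ L ∣) where

      link-from? : Decidable (λ v → ∃ λ i → i ∈ L × Link i v)
      link-from? v = any? λ i → (i ∈? L) ×-dec link? i v

      -- X separates L, the side of T, from the remaining representatives.
      x? : Decidable (λ v → v ∉ L × (IsT v ⊎ ∃ λ i → i ∈ L × Link i v))
      x? v = ¬? (v ∈? L) ×-dec (isT? v ⊎-dec link-from? v)

      X : Subset n
      X = ⟪ x? ⟫

      -- `X` and `L` are disjoint, and their elements are in `T` or are neighbours of `L` in the
      -- matching problem; for `L` this is due to the edges v - v. As `L` has fewer neighbours than
      -- elements, fewer than three elements are left for `X`.
      ∣X∣<3 : ∣ X ∣ < 3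
      ∣X∣<3 = +-cancelʳ-< ∣ L ∣ ∣ X ∣ 3 (begin-strict
        ∣ X ∣ + ∣ L ∣ ≤⟨ disjoint⇒∣p∣+∣q∣≤∣p∪q∣ X L (proj₁ ∘ ∈⟪⟫⁻ x?) ⟩
        ∣ X ∪ L ∣     ≤⟨ p⊆q⇒∣p∣≤∣q∣ X∪L⊆T∪N ⟩
        ∣ T ∪ N ∣     ≤⟨ ∣p∪q∣≤∣p∣+∣q∣ T N ⟩
        ∣ T ∣ + ∣ N ∣ ≤⟨ +-monoˡ-≤ ∣ N ∣ (∣image∣≤ t T (∈⟪⟫⁻ isT?)) ⟩
        3 + ∣ N ∣     <⟨ +-monoʳ-< 3 N<L ⟩
        3 + ∣ L ∣     ∎)
        where
        open ≤-Reasoning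
        T = ⟪ isT? ⟫
        N = ⟪ neighbour? L ⟫
        T⊎N : ∀ {v} → IsT v ⊎ (∃ λ i → i ∈ L × Link i v) → v ∈ T ∪ N
        T⊎N (inj₁ Tv) = x∈p∪q⁺ (inj₁ (∈⟪⟫⁺ isT? Tv))
        T⊎N {v} (inj₂ (i , i∈L , iv)) with isT? v
        ... | yes Tv = x∈p∪q⁺ (inj₁ (∈⟪⟫⁺ isT? Tv))
        ... | no ¬Tv = x∈p∪q⁺ (inj₂ (∈⟪⟫⁺ (neighbour? L) (i , i∈L , ¬Tv , iv)))
        X∪L⊆T∪N : ∀ {v} → v ∈ X ∪ L → v ∈ T ∪ N
        X∪L⊆T∪N {v} v∈ with x∈p∪q⁻ X L v∈
        ... | inj₁ v∈X = T⊎N (proj₂ (∈⟪⟫⁻ x? v∈X))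
        ... | inj₂ v∈L = T⊎N (inj₂ (v , v∈L , inj₁ (L⊆p v∈L , inj₁ refl)))

      X∌three : ∀ {a b c} → a ∈ X → b ∈ X → c ∈ X → b ≢ a → c ≢ a → c ≢ b → ⊥
      X∌three a∈ b∈ c∈ b≢a c≢a c≢b = <⇒≱ ∣X∣<3 (three∈⇒3≤∣p∣ a∈ b∈ c∈ b≢a c≢a c≢b)

      t∈L⊎X : ∀ m → t m ∈ L ⊎ t m ∈ X
      t∈L⊎X m with t m ∈? L
      ... | yes ∈L = inj₁ ∈L
      ... | no ∉L  = inj₂ (∈⟪⟫⁺ x? (∉L , inj₁ (m , refl)))

      -- Otherwise all three vertices of `T` would be in `X`.
      L-meets-t : ∃ λ m → t m ∈ L
      L-meets-t with any? (λ m → t m ∈? L)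
      ... | yes found = found
      ... | no none = ⊥-elim (X∌three (t∈X zero) (t∈X (suc zero)) (t∈X (suc (suc zero)))
          (λ e → 0≢1+n (≡-sym (t-injective e))) (λ e → 0≢1+n (≡-sym (t-injective e)))
          (λ e → 0≢1+n (suc-injective (≡-sym (t-injective e)))))
        where
        t∈X : ∀ m → t m ∈ X
        t∈X m = [ (λ ∈L → contradiction (m , ∈L) none) , id ]′ (t∈L⊎X m)

      m₀ : Fin 3
      m₀ = proj₁ L-meets-t

      t₀∈L : t m₀ ∈ L
      t₀∈L = proj₂ L-meets-t

      neighbour-in : ∀ {i v} → i ∈ L → Adj G i v → v ∉ L → part v ≡ p → v ∈ X
      neighbour-in i∈L iv v∉L ≡p = ∈⟪⟫⁺ x? (v∉L , inj₂ (_ , i∈L , inj₁ (≡p , inj₂ iv)))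

      neighbour-out : ∀ {i v} → i ∈ L → Adj G i v → part v ≢ p → rep (part v) ∈ X
      neighbour-out {i} {v} i∈L iv ≢p = ∈⟪⟫⁺ x?
        ( (λ ∈L → ≢p (trans (≡-sym (part-rep (part v))) (L⊆p ∈L)))
        , inj₂ (i , i∈L , inj₂ ( (λ ≡p → ≢p (trans (≡-sym (part-rep (part v))) ≡p))
                               , cong rep (part-rep (part v))
                               , v , ≡-sym (part-rep (part v)) , iv)))

      -- If `X` missed the branch set `p`, connectivity would put all of `p` into `L`. Every other
      -- branch set is adjacent to `p`, so `X` would contain all four of their representatives.
      inner : ∃ λ u → u ∈ X × part u ≡ p
      inner with any? (λ u → (u ∈? X) ×-dec (part u ≟ p))
      ... | yes found = found
      ... | no none with avoid p p p
      ...   | l₁ , l₁≢p , _ with avoid p l₁ l₁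
      ...     | l₂ , l₂≢p , l₂≢l₁ , _ with avoid p l₁ l₂
      ...       | l₃ , l₃≢p , l₃≢l₁ , l₃≢l₂ = ⊥-elim (X∌three (rep∈X l₁≢p) (rep∈X l₂≢p) (rep∈X l₃≢p)
                    (l₂≢l₁ ∘ rep-injective) (l₃≢l₁ ∘ rep-injective) (l₃≢l₂ ∘ rep-injective))
        where
        p⊆L : ∀ {v} → part v ≡ p → v ∈ L
        p⊆L {v} ≡p = closed (_∈? L) cl (part-connected p (t m₀) v (L⊆p t₀∈L) ≡p) t₀∈L
          where
          cl : ∀ {w v} → w ∈ L → part v ≡ p → Adj G w v → v ∈ L
          cl {v = v} w∈L ≡p wv with v ∈? L
          ... | yes v∈L = v∈L
          ... | no v∉L  = contradiction (v , neighbour-in w∈L wv v∉L ≡p , ≡p) none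
        rep∈X : ∀ {l} → l ≢ p → rep l ∈ X
        rep∈X {l} l≢p with part-joined p l (l≢p ∘ ≡-sym)
        ... | y , z , part-y , refl , yz = neighbour-out (p⊆L part-y) yz l≢p

      -- Otherwise no edge of `G` minus `X` leaves `L`. By 3-connectivity `L` would then reach a
      -- representative outside `p`, although it lies in `p`.
      outer : ∃ λ j → rep j ∈ X × j ≢ p
      outer with any? (λ j → (rep j ∈? X) ×-dec ¬? (j ≟ p))
      ... | yes found = found
      ... | no none with avoid p p p
      ...   | l , l≢p , _ = ⊥-elim (l≢p (trans (≡-sym (part-rep l)) (L⊆p (closed (_∈? L) cl
                (3-conn X ∣X∣<3 (t m₀) (rep l) (λ ∈X → proj₁ (∈⟪⟫⁻ x? ∈X) t₀∈L) (λ ∈X → none (l , ∈X , l≢p)))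
                t₀∈L))))
        where
        cl : ∀ {w v} → w ∈ L → v ∉ X → Adj G w v → v ∈ L
        cl {v = v} w∈L v∉X wv with v ∈? L
        ... | yes v∈L = v∈L
        ... | no v∉L with part v ≟ p
        ...   | yes ≡p = contradiction (neighbour-in w∈L wv v∉L ≡p) v∉X
        ...   | no ≢p  = contradiction (part v , neighbour-out w∈L wv ≢p , ≢p) none

      module _ {u : Fin n} (u∈X : u ∈ X) (part-u : part u ≡ p) {j : Fin 5} (rep∈X : rep j ∈ X) (j≢p : j ≢ p) where

        X⊆ : ∀ {v} → v ∈ X → v ≡ u ⊎ v ≡ rep j
        X⊆ {v} v∈X with v ≟ u | v ≟ rep j
        ... | yes ≡u | _         = inj₁ ≡u
        ... | no _   | yes ≡rep  = inj₂ ≡rep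
        ... | no ≢u  | no ≢rep   = ⊥-elim (X∌three u∈X rep∈X v∈X
          (λ e → j≢p (trans (≡-sym (part-rep j)) (trans (cong part e) part-u))) ≢u ≢rep)

        -- `S` is the component of `t m₀` in the subgraph induced by `L`. It contains every vertex
        -- of `T` in `L`, as these are adjacent to `t m₀`.
        s? : Decidable (Path (λ v w → w ∈ L × Adj G v w) (t m₀))
        s? = path? (λ v w → (w ∈? L) ×-dec adj? v w) (t m₀)

        S : Subset n
        S = ⟪ s? ⟫

        t₀∈S : t m₀ ∈ S
        t₀∈S = ∈⟪⟫⁺ s? done

        S⊆L : ∀ {v} → v ∈ S → v ∈ L
        S⊆L v∈S with ∈⟪⟫⁻ s? v∈S
        ... | done            = t₀∈L
        ... | _ ∷ʳ (v∈L , _) = v∈L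

        S⊆p : ∀ {v} → v ∈ S → part v ≡ p
        S⊆p = L⊆p ∘ S⊆L

        S-connected : InducedConnected G (_∈ S)
        S-connected v w v∈S w∈S = Reach-trans (Reach-sym (from-t (∈⟪⟫⁻ s? v∈S))) (from-t (∈⟪⟫⁻ s? w∈S))
          where
          from-t : ∀ {v} → Path (λ v w → w ∈ L × Adj G v w) (t m₀) v → Reach G (_∈ S) (t m₀) v
          from-t done = here t₀∈S
          from-t (o ∷ʳ e@(_ , vw)) = step (from-t o) vw (∈⟪⟫⁺ s? (o ∷ʳ e))

        -- A neighbour of the component outside it is not in `L`, so it or the representative of its
        -- branch set is in `X`, which is just `u` and `rep j`.
        S-attached : ∀ {s v} → s ∈ S → Adj G s v → v ∉ S → v ≡ u ⊎ part v ≡ j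
        S-attached {s} {v} s∈S sv v∉S with v ∈? L
        ... | yes v∈L = contradiction (∈⟪⟫⁺ s? (∈⟪⟫⁻ s? s∈S ∷ʳ (v∈L , sv))) v∉S
        ... | no v∉L with part v ≟ p
        ...   | yes ≡p with X⊆ (neighbour-in (S⊆L s∈S) sv v∉L ≡p)
        ...     | inj₁ ≡u   = inj₁ ≡u
        ...     | inj₂ refl = inj₂ (part-rep j)
        S-attached {s} {v} s∈S sv v∉S | no v∉L | no ≢p with X⊆ (neighbour-out (S⊆L s∈S) sv ≢p)
        ...     | inj₁ ≡u   = contradiction (trans (≡-sym (part-rep (part v))) (trans (cong part ≡u) part-u)) ≢p
        ...     | inj₂ ≡rep = inj₂ (rep-injective ≡rep)

        u∉S : u ∉ S
        u∉S u∈S = proj₁ (∈⟪⟫⁻ x? u∈X) (S⊆L u∈S)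

        t∈S : ∀ m → t m ∈ S ⊎ (t m ≡ u ⊎ t m ≡ rep j)
        t∈S m with t∈L⊎X m
        ... | inj₂ ∈X = inj₂ (X⊆ ∈X)
        ... | inj₁ ∈L with m ≟ m₀
        ...   | yes refl = inj₁ t₀∈S
        ...   | no m≢m₀  = inj₁ (∈⟪⟫⁺ s? (done ∷ʳ (∈L , t-adj (m≢m₀ ∘ ≡-sym))))

        cut : Cut
        cut = record
          { u = u ; j = j ; S = S ; m₀ = m₀ ; part-u = part-u ; j≢p = j≢p ; u∉S = u∉S ; S⊆p = S⊆p
          ; S-connected = S-connected ; S-attached = S-attached ; t₀∈S = t₀∈S ; t∈S = t∈S }

      find-cut : Cut
      find-cut = let u , u∈X , part-u = inner ; j , rep∈X , j≢p = outer in cut u∈X part-u rep∈X j≢p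

    -- Moving the set behind the cut

    module FromCut (cut : Cut) where
      open Cut cut

      S-attached-p : ∀ {s v} → s ∈ S → Adj G s v → v ∉ S → part v ≡ p → v ≡ u
      S-attached-p s∈S sv v∉S ≡p with S-attached s∈S sv v∉S
      ... | inj₁ ≡u = ≡u
      ... | inj₂ ≡j = contradiction (trans (≡-sym ≡j) ≡p) j≢p

      -- By 3-connectivity `u` and `w` do not separate `t m₀` from `rep l`; the conditions on `l`
      -- make sure that `rep l` is neither of them and not in `S`.
      escape : ∀ w → w ∉ S → ∀ {l} → l ≢ p → part w ≢ l → ∃₂ λ s v → s ∈ S × v ∉ S × Adj G s v × v ≢ u × v ≢ w
      escape w w∉S {l} l≢p w≢l with exit (_∈? S)
        (3-conn (⁅ u ⁆ ∪ ⁅ w ⁆) (∣⁅v⁆∪⁅w⁆∣<3 u w) (t m₀) (rep l)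
          (∉uw (λ e → u∉S (subst (_∈ S) e t₀∈S)) (λ e → w∉S (subst (_∈ S) e t₀∈S)))
          (∉uw (λ e → l≢p (trans (≡-sym (part-rep l)) (trans (cong part e) part-u)))
               (λ e → w≢l (trans (cong part (≡-sym e)) (part-rep l)))))
        t₀∈S (λ ∈S → l≢p (trans (≡-sym (part-rep l)) (S⊆p ∈S)))
        where
        ∉uw : ∀ {v} → v ≢ u → v ≢ w → v ∉ ⁅ u ⁆ ∪ ⁅ w ⁆
        ∉uw ≢u ≢w v∈ = [ ≢u ∘ x∈⁅y⁆⇒x≡y u , ≢w ∘ x∈⁅y⁆⇒x≡y w ]′ (x∈p∪q⁻ ⁅ u ⁆ ⁅ w ⁆ v∈)
      ... | s , v , s∈S , v∉S , sv , _ , v∉uw =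
        s , v , s∈S , v∉S , sv , (λ { refl → v∉uw (x∈p∪q⁺ (inj₁ (x∈⁅x⁆ u))) }) ,
        (λ { refl → v∉uw (x∈p∪q⁺ (inj₂ (x∈⁅x⁆ w))) })

      part′ : Fin n → Fin 5
      part′ v with v ∈? S
      ... | yes _ = j
      ... | no _  = part v

      part′-S : ∀ {v} → v ∈ S → part′ v ≡ j
      part′-S {v} v∈S with v ∈? S
      ... | yes _  = refl
      ... | no v∉S = contradiction v∈S v∉S

      part′-∉S : ∀ {v i} → v ∉ S → part v ≡ i → part′ v ≡ i
      part′-∉S {v} v∉S refl with v ∈? S
      ... | yes v∈S = contradiction v∈S v∉S
      ... | no _    = refl

      part′-≢p : ∀ {v i} → i ≢ p → part v ≡ i → part′ v ≡ i
      part′-≢p i≢p e = part′-∉S (λ v∈S → i≢p (trans (≡-sym e) (S⊆p v∈S))) e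

      part′⁻ : ∀ {v i} → part′ v ≡ i → (v ∈ S × i ≡ j) ⊎ (v ∉ S × part v ≡ i)
      part′⁻ {v} e with v ∈? S
      ... | yes v∈S = inj₁ (v∈S , ≡-sym e)
      ... | no v∉S  = inj₂ (v∉S , e)

      ≢j⇒part : ∀ {v i} → i ≢ j → part′ v ≡ i → v ∉ S × part v ≡ i
      ≢j⇒part i≢j e = [ (λ (_ , i≡j) → contradiction i≡j i≢j) , id ]′ (part′⁻ e)

      -- With `w` taken to be `u` as well, `escape` gives an edge leaving `S` that avoids `u`; it
      -- can only lead to the branch set `j`.
      S-joined-j : ∃₂ λ s v → s ∈ S × part v ≡ j × Adj G s v
      S-joined-j with avoid p j j
      ... | l , l≢p , l≢j , _ with escape u u∉S l≢p (λ e → l≢p (trans (≡-sym e) part-u))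
      ...   | s , v , s∈S , v∉S , sv , v≢u , _ with S-attached s∈S sv v∉S
      ...     | inj₁ v≡u = contradiction v≡u v≢u
      ...     | inj₂ ≡j  = s , v , s∈S , ≡j , sv

      S-joined-u : ∃ λ s → s ∈ S × Adj G s u
      S-joined-u with exit (_∈? S) (part-connected p (t m₀) u (S⊆p t₀∈S) part-u) t₀∈S u∉S
      ... | s , v , s∈S , v∉S , sv , _ , ≡p with S-attached-p s∈S sv v∉S ≡p
      ...   | refl = s , s∈S , sv

      connected′ : ∀ i → InducedConnected G (λ v → part′ v ≡ i)
      connected′ i with i ≟ j
      ... | yes refl with S-joined-j
      ...   | s , v , s∈S , ≡j , sv = connected-resp [ part′-S , part′-≢p j≢p ]′
        (λ e → [ inj₁ ∘ proj₁ , inj₂ ∘ proj₂ ]′ (part′⁻ e))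
        (connected-⊎ S-connected (part-connected j) s∈S ≡j sv)
      connected′ i | no i≢j with i ≟ p
      ...   | yes refl = connected-resp (λ (e , v∉S) → part′-∉S v∉S e)
        (λ e → let v∉S , e′ = ≢j⇒part i≢j e in e′ , v∉S)
        (connected-∖ (_∈? S) (part-connected p) part-u u∉S
          (λ s∈S ≡p v∉S sv → S-attached-p s∈S sv v∉S ≡p))
      ...   | no i≢p = connected-resp (part′-≢p i≢p) (proj₂ ∘ ≢j⇒part i≢j) (part-connected i)

      nonempty′ : ∀ i → ∃ λ v → part′ v ≡ i
      nonempty′ i with i ≟ p
      ... | yes refl = u , part′-∉S u∉S part-u
      ... | no i≢p   = rep i , part′-≢p i≢p (part-rep i)

      Joined : Fin 5 → Fin 5 → Set
      Joined i k = ∃₂ λ v w → part′ v ≡ i × part′ w ≡ k × Adj G v w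

      -- An edge from `u` back to `S` joins `p` to `j`. For other `k` the old edge survives: outside
      -- `p`, `S` has neighbours in `j` only.
      joined-p : ∀ k → k ≢ p → Joined p k
      joined-p k k≢p with k ≟ j
      ... | yes refl = let s , s∈S , su = S-joined-u in
        u , s , part′-∉S u∉S part-u , part′-S s∈S , Adj-sym {G = G} su
      ... | no k≢j with part-joined p k (k≢p ∘ ≡-sym)
      ...   | y , z , part-y , part-z , yz = y , z , part′-∉S y∉S part-y , part′-≢p k≢p part-z , yz
        where
        y∉S : y ∉ S
        y∉S y∈S with S-attached y∈S yz (λ z∈S → k≢p (trans (≡-sym part-z) (S⊆p z∈S)))
        ... | inj₁ refl = k≢p (trans (≡-sym part-z) part-u)
        ... | inj₂ ≡j   = k≢j (trans (≡-sym part-z) ≡j)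

      joined-off : ∀ i k → i ≢ p → k ≢ p → i ≢ k → Joined i k
      joined-off i k i≢p k≢p i≢k = let v , w , ev , ew , vw = part-joined i k i≢k in
        v , w , part′-≢p i≢p ev , part′-≢p k≢p ew , vw

      -- The roles change: `j` takes the place of `p`, the remainder of `p` that of `q`, and `u`
      -- that of `x`. Without `S` the new branch set `j` is the old one, which gives the two fields
      -- on the rest.
      state′ : State S
      state′ = record
        { M = record
          { part           = part′
          ; part-nonempty  = nonempty′
          ; part-connected = connected′
          ; part-joined    = joined-from p (λ (v , w , ev , ew , vw) → w , v , ew , ev , Adj-sym {G = G} vw)
                               joined-p joined-off
          }
        ; p = j
        ; q = p
        ; x = u
        ; q≢p = j≢p ∘ ≡-sym
        ; part-x = part′-∉S u∉S part-u
        ; t∈ = λ m → [ inj₁ ∘ part′-S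
                     , [ inj₂ , (λ e → inj₁ (part′-≢p j≢p (trans (cong part e) (part-rep j)))) ]′ ]′ (t∈S m)
        ; W⊆p = part′-S
        ; W-connected = S-connected
        ; W-meets-t = λ _ → m₀ , t₀∈S
        ; rest-connected = connected-resp
            (λ e → part′-≢p j≢p e , λ v∈S → j≢p (trans (≡-sym e) (S⊆p v∈S)))
            (λ (e , v∉S) → [ (λ (v∈S , _) → contradiction v∈S v∉S) , proj₂ ]′ (part′⁻ e))
            (part-connected j)
        ; rest-joined = λ l l≢j l≢p → let y , z , ey , ez , yz = part-joined j l (l≢j ∘ ≡-sym) in
            y , z , part′-≢p j≢p ey , (λ y∈S → j≢p (trans (≡-sym ey) (S⊆p y∈S))) , part′-≢p l≢p ez , yz
        ; W-attached = attached′
        }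
        where
        attached′ : ∀ {w v} → w ∈ S → Adj G w v → part′ v ≡ j ⊎ v ≡ u
        attached′ {v = v} w∈S wv with v ∈? S
        ... | yes v∈S = inj₁ refl
        ... | no v∉S with S-attached w∈S wv v∉S
        ...   | inj₁ ≡u = inj₂ ≡u
        ...   | inj₂ ≡j = inj₁ ≡j

      -- Suppose `S` is contained in `W`. An edge leaving `S` that avoids `u` and `x` must, by
      -- `W-attached`, end in `p`, and there `S` has only the neighbour `u`.
      S-meets-rest : ∃ λ s → s ∈ S × s ∉ W
      S-meets-rest with any? (λ s → (s ∈? S) ×-dec ¬? (s ∈? W))
      ... | yes found = found
      ... | no none with avoid p q q
      ...   | l , l≢p , l≢q , _
        with escape x (λ x∈S → q≢p (trans (≡-sym part-x) (S⊆p x∈S))) l≢p (λ e → l≢q (trans (≡-sym e) part-x))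
      ...     | s , v , s∈S , v∉S , sv , v≢u , v≢x with s ∈? W
      ...       | no s∉W = contradiction (s , s∈S , s∉W) none
      ...       | yes s∈W with W-attached s∈W sv
      ...         | inj₁ ≡p = contradiction (S-attached-p s∈S sv v∉S ≡p) v≢u
      ...         | inj₂ ≡x = contradiction ≡x v≢x

      -- If `u` were in `W`, the connected set `p` minus `W` would avoid `u` and meet `S`, hence lie
      -- in `S`. But it is joined to some `l` other than `p`, `q` and `j`, and `S` is not.
      u∉W : u ∉ W
      u∉W u∈W with S-meets-rest | avoid p q j
      ... | s , s∈S , s∉W | l , l≢p , l≢q , l≢j with rest-joined l l≢p l≢q
      ...   | y , z , part-y , y∉W , part-z , yz
        with S-attached (closed (_∈? S) cl (rest-connected s y (S⊆p s∈S , s∉W) (part-y , y∉W)) s∈S) yz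
               (λ z∈S → l≢p (trans (≡-sym part-z) (S⊆p z∈S)))
        where
        cl : ∀ {w v} → w ∈ S → part v ≡ p × v ∉ W → Adj G w v → v ∈ S
        cl {v = v} w∈S (≡p , v∉W) wv with v ∈? S
        ... | yes v∈S = v∈S
        ... | no v∉S  = contradiction (subst (_∈ W) (≡-sym (S-attached-p w∈S wv v∉S ≡p)) u∈W) v∉W
      ...     | inj₁ refl = l≢p (trans (≡-sym part-z) part-u)
      ...     | inj₂ ≡j   = l≢j (trans (≡-sym part-z) ≡j)

      -- A nonempty `W` contains a vertex of `T`. That vertex is neither `u` nor `rep j`, so it is
      -- in `S`; as `W` is connected inside `p` and avoids `u`, it cannot leave `S`.
      W⊆S : ∀ {w} → w ∈ W → w ∈ S
      W⊆S {w} w∈W with W-meets-t w∈W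
      ... | m , t∈W with t∈S m
      ...   | inj₂ (inj₁ ≡u)   = contradiction (subst (_∈ W) ≡u t∈W) u∉W
      ...   | inj₂ (inj₂ ≡rep) =
        contradiction (trans (≡-sym (part-rep j)) (trans (cong part (≡-sym ≡rep)) (W⊆p t∈W))) j≢p
      ...   | inj₁ t∈S′ = closed (_∈? S) cl (W-connected (t m) w t∈W w∈W) t∈S′
        where
        cl : ∀ {w v} → w ∈ S → v ∈ W → Adj G w v → v ∈ S
        cl {v = v} w∈S v∈W wv with v ∈? S
        ... | yes v∈S = v∈S
        ... | no v∉S  = contradiction (subst (_∈ W) (S-attached-p w∈S wv v∉S (W⊆p v∈W)) v∈W) u∉W

    advance : Win ⊎ ∃ λ W′ → W ⊂ W′ × State W′
    -- Here `x` is only the default column.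
    advance with hall x (λ v → part v ≟ p)
    ... | inj₁ (f , M-f) = inj₁ (FromMatching.win f M-f)
    ... | inj₂ (L , L⊆p , N<L) = inj₂ (S , ((λ {v} → W⊆S {v}) , S-meets-rest) , state′)
      where
      open Cut (FromViolator.find-cut L L⊆p N<L)
      open FromCut (FromViolator.find-cut L L⊆p N<L)

  -- Iteration and the initial state

  iterate : ∀ {W} → Acc _⊃_ W → State W → Win
  iterate (acc rec) state with Advance.advance state
  ... | inj₁ win              = win
  ... | inj₂ (W′ , W⊂W′ , state′) = iterate (rec W⊂W′) state′

  module _ (M : Partition G) where
    open Partition M

    initial : ∀ {p q x} → q ≢ p → part x ≡ q → (∀ m → part (t m) ≡ p ⊎ t m ≡ x) → Win
    initial {p} {q} {x} q≢p part-x t∈ = iterate (⊃-wellFounded Data.Fin.Subset.⊥) record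
      { M = M ; p = p ; q = q ; x = x ; q≢p = q≢p ; part-x = part-x ; t∈ = t∈
      ; W⊆p = λ v∈ → contradiction v∈ ∉⊥
      ; W-connected = λ u _ u∈ _ → contradiction u∈ ∉⊥
      ; W-meets-t = λ v∈ → contradiction v∈ ∉⊥
      ; rest-connected = connected-resp (_, ∉⊥) proj₁ (part-connected p)
      ; rest-joined = λ l l≢p _ → let y , z , ey , ez , yz = part-joined p l (l≢p ∘ ≡-sym) in
          y , z , ey , ∉⊥ , ez , yz
      ; W-attached = λ w∈ → contradiction w∈ ∉⊥
      }

    -- The three indices come in any order, so that one argument covers every pair of vertices of
    -- `T` sharing a branch set.
    two-in-part : ∀ m m′ m″ → (∀ k → k ≡ m ⊎ k ≡ m′ ⊎ k ≡ m″) → part (t m) ≡ part (t m′) → Win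
    two-in-part m m′ m″ cases e with part (t m″) ≟ part (t m)
    ... | no ≢p = initial ≢p refl λ k → on k (cases k)
      where
      on : ∀ k → k ≡ m ⊎ k ≡ m′ ⊎ k ≡ m″ → part (t k) ≡ part (t m) ⊎ t k ≡ t m″
      on k (inj₁ refl)        = inj₁ refl
      on k (inj₂ (inj₁ refl)) = inj₁ (≡-sym e)
      on k (inj₂ (inj₂ refl)) = inj₂ refl
    -- All of `T` lies in one branch set, so `x` may be any vertex of any other.
    ... | yes ≡p with avoid (part (t m)) (part (t m)) (part (t m))
    ...   | q , q≢p , _ = initial q≢p (proj₂ (part-nonempty q)) λ k → inj₁ (on k (cases k))
      where
      on : ∀ k → k ≡ m ⊎ k ≡ m′ ⊎ k ≡ m″ → part (t k) ≡ part (t m)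
      on k (inj₁ refl)        = refl
      on k (inj₂ (inj₁ refl)) = ≡-sym e
      on k (inj₂ (inj₂ refl)) = ≡p

    separate-triangle : Win
    separate-triangle with part (t 0F) ≟ part (t 1F) | part (t 1F) ≟ part (t 2F) | part (t 2F) ≟ part (t 0F)
    ... | yes e | _ | _ = two-in-part 0F 1F 2F
      (λ { 0F → inj₁ refl ; 1F → inj₂ (inj₁ refl) ; 2F → inj₂ (inj₂ refl) }) e
    ... | no _ | yes e | _ = two-in-part 1F 2F 0F
      (λ { 0F → inj₂ (inj₂ refl) ; 1F → inj₁ refl ; 2F → inj₂ (inj₁ refl) }) e
    ... | no _ | no _ | yes e = two-in-part 2F 0F 1F
      (λ { 0F → inj₂ (inj₁ refl) ; 1F → inj₂ (inj₂ refl) ; 2F → inj₁ refl }) e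
    ... | no 0≢1 | no 1≢2 | no 2≢0 = M , inj
      where
      inj : Injective _≡_ _≡_ (part ∘ t)
      inj {0F} {0F} _ = refl
      inj {1F} {1F} _ = refl
      inj {2F} {2F} _ = refl
      inj {0F} {1F} e = contradiction e 0≢1
      inj {1F} {0F} e = contradiction (≡-sym e) 0≢1
      inj {1F} {2F} e = contradiction e 1≢2
      inj {2F} {1F} e = contradiction (≡-sym e) 1≢2
      inj {2F} {0F} e = contradiction e 2≢0
      inj {0F} {2F} e = contradiction (≡-sym e) 2≢0

theorem1p4 : ∀ {n : ℕ} (G : Graph n) → ThreeConnected G → (T : Triangle G) →
    HasK5Minor G → Σ (K5Model G) λ M → PreservesTriangle M T
theorem1p4 {n} G (_ , 3-conn) T K = model (proj₁ win) , part (t 0F) , part (t 1F) , part (t 2F) ,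
  refl , refl , refl , (λ e → contradiction (part-t-injective {0F} {1F} e) (λ ())) ,
  (λ e → contradiction (part-t-injective {1F} {2F} e) (λ ())) ,
  (λ e → contradiction (part-t-injective {2F} {0F} e) (λ ()))
  where
  open Triangle T
  t : Fin 3 → Fin n
  t 0F = a
  t 1F = b
  t 2F = c
  t-adj : ∀ {m m′} → m ≢ m′ → Adj G (t m) (t m′)
  t-adj {0F} {0F} ≢ = contradiction refl ≢
  t-adj {1F} {1F} ≢ = contradiction refl ≢
  t-adj {2F} {2F} ≢ = contradiction refl ≢
  t-adj {0F} {1F} _ = ab
  t-adj {1F} {0F} _ = Adj-sym {G = G} ab
  t-adj {1F} {2F} _ = bc
  t-adj {2F} {1F} _ = Adj-sym {G = G} bc
  t-adj {2F} {0F} _ = ca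
  t-adj {0F} {2F} _ = Adj-sym {G = G} ca
  connG : InducedConnected G (λ _ → ⊤)
  connG = connected-resp _ (λ _ → ∉⊥)
    (3-conn Data.Fin.Subset.⊥ (subst (_< 3) (≡-sym (∣⊥∣≡0 n)) (s≤s z≤n)))
  win : Σ (Partition G) λ M → Injective _≡_ _≡_ (Partition.part M ∘ t)
  win = separate-triangle 3-conn t t-adj (partition connG K)
  open Partition (proj₁ win)
  part-t-injective : ∀ {m m′} → part (t m) ≡ part (t m′) → m ≡ m′
  part-t-injective = proj₂ win
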